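{- For every ordered graph $G$ there is a constant $c$ (depending on $G$) such that for all integers $n\ge 1$, \[ r_o(G,C_n)\le r_o(G,P_m)+c,\qquad\text{where } m=(n-1)(|V(G)|-1)+1 . \]
   Context: An ordered graph is a graph with a linear ordering on its vertices; subgraphs inherit the ordering, and copies are taken via order-preserving isomorphisms. The ordered path $P_n$ has vertices $v_1<\dots<v_n$ and edges $v_iv_{i+1}$; the ordered cycle $C_n$ is obtained from $P_n$ by adding the edge $v_1v_n$. The online ordered Ramsey game for ordered graphs $G,H$ is played on vertex set $\mathbb N$ with its usual order: on each turn Builder draws a new edge between two vertices and Painter colors it red or blue; the game ends when there is a red copy of $G$ or a blue copy of $H$. Builder minimizes and Painter maximizes the number of turns; $r_o(G,H)$ is the number of turns under optimal play. -}

module Defs where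

open import Data.Nat using (ℕ; zero; suc; _+_; _*_; _∸_; _<_; _≡ᵇ_)
open import Data.Bool using (Bool; true; false; _∨_; _∧_)
open import Data.Fin using (Fin; toℕ)
open import Data.Product using (_×_; _,_; Σ)
open import Data.List using (List; []; _∷_)
open import Data.List.Membership.Propositional using (_∈_)
open import Relation.Binary.PropositionalEquality using (_≡_)
open import Relation.Nullary using (¬_)

-- An ordered graph on vertex set {0 < 1 < ... < size-1} (Fin size with its
-- natural order).  Only the entries adj i j with toℕ i < toℕ j are meaningful:
-- the edge set is { ij : i < j , adj i j ≡ true }.
record OrdGraph : Set where
  field
    size : ℕ
    adj  : Fin size → Fin size → Bool
open OrdGraph public

Path : ℕ → OrdGraph
Path n = record { size = n ; adj = λ i j → suc (toℕ i) ≡ᵇ toℕ j }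

Cycle : ℕ → OrdGraph
Cycle n = record { size = n
                 ; adj = λ i j → (suc (toℕ i) ≡ᵇ toℕ j)
                                 ∨ ((toℕ i ≡ᵇ 0) ∧ (suc (toℕ j) ≡ᵇ n)) }

data Colour : Set where
  red blue : Colour

-- A position of the game: the list of edges drawn so far (as pairs a < b of
-- vertices of ℕ) together with the colour Painter gave them.
History : Set
History = List (ℕ × ℕ × Colour)

MonoCopy : OrdGraph → Colour → History → Set
MonoCopy G c h =
  Σ (Fin (size G) → ℕ) λ f →
    ((i j : Fin (size G)) → toℕ i < toℕ j → f i < f j) ×
    ((i j : Fin (size G)) → toℕ i < toℕ j → adj G i j ≡ true → (f i , f j , c) ∈ h)

data Ended (G H : OrdGraph) (h : History) : Set where
  redG  : MonoCopy G red h  → Ended G H h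
  blueH : MonoCopy H blue h → Ended G H h

data BuilderWins (G H : OrdGraph) : ℕ → History → Set where
  ended : ∀ {t h} → Ended G H h → BuilderWins G H t h
  move  : ∀ {t h} (a b : ℕ) → a < b →
          ((c : Colour) → ¬ ((a , b , c) ∈ h)) →
          ((c : Colour) → BuilderWins G H t ((a , b , c) ∷ h)) →
          BuilderWins G H (suc t) h

-- r_o(G , H) ≤ t  (r_o is the least t with BuilderWins G H t []).
RoLe : OrdGraph → OrdGraph → ℕ → Set
RoLe G H t = BuilderWins G H t []

{-# OPTIONS --safe #-}
module Submission where

-- Put N = |V(G)| and d = n - 1. Builder first forces a blue path of d(N-1) edges, and then
-- draws all edges within boundedly many sets of boundedly many vertices, so that each of these
-- sets may be assumed to contain no red clique of size N. On N path vertices at distance d this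
-- gives a blue chord spanning D = kd path edges, where k ≥ 1; if k = 1 the cycle is closed.
-- Otherwise a blue walk of d edges is needed between the ends of the chord, assembled from:
--  * a bounded piece containing a large blue clique (Ramsey), which can be crossed with any
--    number of edges from a long interval of consecutive integers;
--  * windows of N equally spaced vertices, of which many save the same number of units of
--    length g, so that any multiple of Λ units up to N - 2 of them can be saved, Λ = (N-1)!;
--  * a plain piece of the path;
--  * a grid of boundedly many steps of length Λg, which can be crossed by blue edges and at
--    most N - 2 plain steps: from each vertex jump to its last blue neighbour, then take one
--    step; every vertex left behind is red to all of the following ones.
-- The windows compensate exactly for the number of plain steps in the last piece, and all
-- remaining errors are bounded, hence absorbed by the first piece. For d bounded in terms of N,
-- Ramsey's theorem alone yields the cycle.

open import Defs
open import Data.Nat using (ℕ; suc; _+_; _*_; _∸_; _≥_)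
open import Data.Product using (Σ)
open import Data.Bool using (true)
open import Data.Bool.Properties using (T-≡; T-∧; T-∨)
open import Data.Fin using (Fin; zero; suc; toℕ; fromℕ<; inject≤)
open import Data.Fin.Properties using (toℕ-injective; toℕ-fromℕ<; toℕ-inject≤; toℕ<n)
open import Data.List using (List; []; _∷_; length; lookup; applyUpTo)
open import Data.List.Membership.Propositional using (_∈_)
open import Data.List.Membership.Propositional.Properties using (∈-lookup; ∈-applyUpTo⁻)
open import Data.List.Properties using (length-applyUpTo)
open import Data.List.Relation.Binary.Sublist.Propositional as Sublist using ([]; _∷_; _∷ʳ_)
open import Data.List.Relation.Binary.Sublist.Propositional.Properties using (All-resp-⊆)
open import Data.List.Relation.Binary.Subset.Propositional using (_⊆_)
open import Data.List.Relation.Unary.All as All using (All; []; _∷_)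
open import Data.List.Relation.Unary.AllPairs using (AllPairs; []; _∷_)
open import Data.List.Relation.Unary.AllPairs.Properties using (applyUpTo⁺₁)
open import Data.List.Relation.Unary.Any using (here; there)
open import Data.Nat using (zero; _≤_; _<_; z≤n; s≤s; s≤s⁻¹; _≡ᵇ_; _!; _/_; _%_; _≟_; _≤?_; _<?_)
open import Data.Nat using (NonZero; >-nonZero; >-nonZero⁻¹)
open import Data.Nat.DivMod using (m≡m%n+[m/n]*n; m%n≤n)
open import Data.Nat.Divisibility using (_∣_; divides; ∣-trans; m∣m*n; m≤n⇒m!∣n!)
open import Data.Nat.Properties
open import Data.Nat.Tactic.RingSolver using (solve-∀)
open import Data.Product using (∃; ∃₂; _×_; _,_; proj₁; proj₂)
open import Data.Product.Properties using () renaming (≡-dec to ×-≡-dec)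
open import Data.Sum using (_⊎_; inj₁; inj₂)
open import Function using (_∘_; id)
open import Function.Bundles using (Equivalence)
open import Level using (0ℓ)
open import Relation.Binary.Core using (Rel)
open import Relation.Binary.Definitions using (DecidableEquality)
open import Relation.Binary.PropositionalEquality
  using (_≡_; refl; sym; trans; cong; subst; subst₂; module ≡-Reasoning)
open import Relation.Nullary using (yes; no; contradiction)
open import Relation.Unary using (Pred; _∪_)
import Data.List.Membership.DecPropositional as DecMembership

variable
  A : Set
  R B : Rel A 0ℓ
  xs : List A
  h h′ : History
  G H : OrdGraph
  t : ℕ

-- Ramsey's theorem for sequences

AllPairs-resp-⊆ : ∀ {ys} → ys Sublist.⊆ xs → AllPairs R xs → AllPairs R ys
AllPairs-resp-⊆ []         []         = []
AllPairs-resp-⊆ (_ ∷ʳ s)   (_ ∷ pxs)  = AllPairs-resp-⊆ s pxs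
AllPairs-resp-⊆ (refl ∷ s) (px ∷ pxs) = All-resp-⊆ s px ∷ AllPairs-resp-⊆ s pxs

split : {P Q : Pred A 0ℓ} → All (P ∪ Q) xs → ∃₂ λ ys zs →
        ys Sublist.⊆ xs × zs Sublist.⊆ xs × All P ys × All Q zs ×
        length ys + length zs ≡ length xs
split [] = [] , [] , [] , [] , [] , [] , refl
split (inj₁ p ∷ pqs) with split pqs
... | ys , zs , s , s′ , ps , qs , eq =
  _ , zs , refl ∷ s , _ ∷ʳ s′ , p ∷ ps , qs , cong suc eq
split (inj₂ q ∷ pqs) with split pqs
... | ys , zs , s , s′ , ps , qs , eq =
  ys , _ , _ ∷ʳ s , refl ∷ s′ , ps , q ∷ qs , trans (+-suc _ _) (cong suc eq)

Clique : Rel A 0ℓ → ℕ → List A → Set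
Clique R k xs = ∃ λ ys → ys Sublist.⊆ xs × length ys ≡ k × AllPairs R ys

Clique-resp-⊆ : ∀ {k ys} → ys Sublist.⊆ xs → Clique R k ys → Clique R k xs
Clique-resp-⊆ s (zs , s′ , len , pairs) = zs , Sublist.⊆-trans s′ s , len , pairs

Clique-∷ : ∀ {k x ys} → ys Sublist.⊆ xs → All (R x) ys → Clique R k ys → Clique R (suc k) (x ∷ xs)
Clique-∷ s rs (zs , s′ , len , pairs) =
  _ , refl ∷ Sublist.⊆-trans s′ s , cong suc len , All-resp-⊆ s′ rs ∷ pairs

ramsey : ℕ → ℕ → ℕ
ramsey zero    _       = 0
ramsey (suc a) zero    = 0
ramsey (suc a) (suc b) = suc (ramsey a (suc b) + ramsey (suc a) b)

-- The red and blue neighbours of the head partition the tail, so if there are fewer than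
-- `ramsey a (suc b)` red ones, at least `ramsey (suc a) b` are blue. Cliques are sublists, hence
-- ordered.
ramsey-clique : ∀ a b → ramsey a b ≤ length xs → AllPairs (λ x y → R x y ⊎ B x y) xs →
                Clique R a xs ⊎ Clique B b xs
ramsey-clique zero    b       _ _ = inj₁ ([] , Sublist.minimum _ , refl , [])
ramsey-clique (suc a) zero    _ _ = inj₂ ([] , Sublist.minimum _ , refl , [])
ramsey-clique (suc a) (suc b) (s≤s le) (px ∷ pxs) with split px
... | ys , zs , s , s′ , rs , bs , eq with ramsey a (suc b) ≤? length ys
... | yes le₁ with ramsey-clique a (suc b) le₁ (AllPairs-resp-⊆ s pxs)
...   | inj₁ c = inj₁ (Clique-∷ s rs c)
...   | inj₂ c = inj₂ (Clique-resp-⊆ (_ ∷ʳ s) c)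
ramsey-clique (suc a) (suc b) (s≤s le) (px ∷ pxs)
    | ys , zs , s , s′ , rs , bs , eq | no ¬le₁
    with ramsey-clique (suc a) b le₂ (AllPairs-resp-⊆ s′ pxs)
  where
  le₂ : ramsey (suc a) b ≤ length zs
  le₂ = +-cancelˡ-≤ (ramsey a (suc b)) _ _
          (≤-trans le (≤-trans (≤-reflexive (sym eq)) (+-monoˡ-≤ _ (<⇒≤ (≰⇒> ¬le₁)))))
...   | inj₁ c = inj₁ (Clique-resp-⊆ (_ ∷ʳ s′) c)
...   | inj₂ c = inj₂ (Clique-∷ s′ bs c)

all-or-any : {P Q : Pred A 0ℓ} → All (P ∪ Q) xs → All P xs ⊎ ∃ λ x → x ∈ xs × Q x
all-or-any [] = inj₁ []
all-or-any (inj₂ q ∷ pqs) = inj₂ (_ , here refl , q)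
all-or-any (inj₁ p ∷ pqs) with all-or-any pqs
... | inj₁ ps            = inj₁ (p ∷ ps)
... | inj₂ (x , x∈ , q)  = inj₂ (x , there x∈ , q)

allPairs-or-any : AllPairs (λ x y → R x y ⊎ B x y) xs →
                  AllPairs R xs ⊎ ∃₂ λ x y → x ∈ xs × y ∈ xs × B x y
allPairs-or-any [] = inj₁ []
allPairs-or-any (px ∷ pxs) with all-or-any px | allPairs-or-any pxs
... | inj₂ (y , y∈ , b) | _                         = inj₂ (_ , y , here refl , there y∈ , b)
... | inj₁ rs           | inj₁ pairs                = inj₁ (rs ∷ pairs)
... | inj₁ _            | inj₂ (x , y , x∈ , y∈ , b) = inj₂ (x , y , there x∈ , there y∈ , b)

AllPairs-lookup : AllPairs R xs → ∀ i j → toℕ i < toℕ j → R (lookup xs i) (lookup xs j)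
AllPairs-lookup (px ∷ _)  zero    (suc j) _         = All.lookup px (∈-lookup j)
AllPairs-lookup (_ ∷ pxs) (suc i) (suc j) (s≤s i<j) = AllPairs-lookup pxs i j i<j

-- Pigeonhole by counting

sumTo : (ℕ → ℕ) → ℕ → ℕ
sumTo f zero    = 0
sumTo f (suc k) = f k + sumTo f k

-- Registers one more window whose cover costs `δ` units.
bump : ℕ → (ℕ → ℕ) → ℕ → ℕ
bump δ f k with k ≟ δ
... | yes _ = suc (f k)
... | no  _ = f k

f≤bump : ∀ δ f k → f k ≤ bump δ f k
f≤bump δ f k with k ≟ δ
... | yes _ = n≤1+n (f k)
... | no  _ = ≤-refl

sumTo-mono : ∀ {f g} → (∀ k → f k ≤ g k) → ∀ k → sumTo f k ≤ sumTo g k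
sumTo-mono le zero    = z≤n
sumTo-mono le (suc k) = +-mono-≤ (le k) (sumTo-mono le k)

bump-self : ∀ δ f → bump δ f δ ≡ suc (f δ)
bump-self δ f with δ ≟ δ
... | yes _  = refl
... | no δ≢δ = contradiction refl δ≢δ

sumTo-bump : ∀ f {δ k} → δ < k → suc (sumTo f k) ≤ sumTo (bump δ f) k
sumTo-bump f {δ} {suc k} (s≤s δ≤k) with m≤n⇒m<n∨m≡n δ≤k
... | inj₂ refl = +-mono-≤ (≤-reflexive (sym (bump-self δ f))) (sumTo-mono (f≤bump δ f) k)
... | inj₁ δ<k  = ≤-trans (≤-reflexive (sym (+-suc (f k) (sumTo f k))))
                    (+-mono-≤ (f≤bump δ f k) (sumTo-bump f δ<k))

pigeonhole : ∀ f J k → suc k * J ≤ sumTo f (suc k) → ∃ λ i → i ≤ k × J ≤ f i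
pigeonhole f J k le with J ≤? f k
... | yes J≤ = k , ≤-refl , J≤
pigeonhole f J zero le | no J≰ = contradiction (+-cancelʳ-≤ 0 J (f 0) le) J≰
pigeonhole f J (suc k) le | no J≰ with pigeonhole f J k
  (+-cancelˡ-≤ J _ _ (≤-trans le (+-monoˡ-≤ _ (<⇒≤ (≰⇒> J≰)))))
... | i , i≤k , J≤ = i , m≤n⇒m≤1+n i≤k , J≤

-- Walks

data Walk (B : Rel A 0ℓ) : A → A → ℕ → Set where
  done : ∀ {x} → Walk B x x 0
  step : ∀ {x y z L} → B x y → Walk B y z L → Walk B x z (suc L)

_⊙_ : ∀ {x y z : A} {L L′} → Walk B x y L → Walk B y z L′ → Walk B x z (L + L′)
done     ⊙ w′ = w′
step b w ⊙ w′ = step b (w ⊙ w′)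

Walk-map : ∀ {B B′ : Rel A 0ℓ} {x y L} → (∀ {x y} → B x y → B′ x y) → Walk B x y L → Walk B′ x y L
Walk-map f done       = done
Walk-map f (step b w) = step (f b) (Walk-map f w)

-- Follow the clique in order and, at any moment, jump to its last member `z`; the end point is
-- therefore the same for every length.
clique-walk : ∀ x y ys → AllPairs B (x ∷ y ∷ ys) →
              ∃ λ z → z ∈ (y ∷ ys) × (∀ L → L ≤ length ys → Walk B x z (suc L))
clique-walk x y [] ((xy ∷ []) ∷ _) = y , here refl , λ { zero z≤n → step xy done }
clique-walk {B = B} x y (y′ ∷ ys) (px@(xy ∷ _) ∷ pxs) with clique-walk y y′ ys pxs
... | z , z∈ , walks = z , there z∈ , walks′
  where
  walks′ : ∀ L → L ≤ suc (length ys) → Walk B x z (suc L)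
  walks′ zero    _        = step (All.lookup px (there z∈)) done
  walks′ (suc L) (s≤s le) = step xy (walks L le)

-- Crossing a grid of points by blue jumps and unit steps

module Grid (R B : Rel ℕ 0ℓ) (p : ℕ → ℕ) where

  Coloured : ℕ → Set
  Coloured b = ∀ {i j} → i < j → j ≤ b → R (p i) (p j) ⊎ B (p i) (p j)

  -- Search downwards from `b`. If no blue neighbour turns up, `j` is `i` itself, reached by the
  -- empty walk.
  last-neighbour : ∀ {i b} → i ≤ b → Coloured b →
    ∃ λ j → i ≤ j × j ≤ b × (∃ λ e → e ≤ 1 × Walk B (p i) (p j) e) ×
            (∀ k → j < k → k ≤ b → R (p i) (p k))
  last-neighbour {i} {b} i≤b col with m≤n⇒m<n∨m≡n i≤b
  ... | inj₂ refl = i , ≤-refl , ≤-refl , (0 , z≤n , done) ,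
                    λ k i<k k≤i → contradiction (≤-trans i<k k≤i) 1+n≰n
  last-neighbour {i} {suc b} _ col | inj₁ (s≤s i≤b) with col (s≤s i≤b) ≤-refl
  ... | inj₂ bl = suc b , m≤n⇒m≤1+n i≤b , ≤-refl , (1 , ≤-refl , step bl done) ,
                    λ k b<k k≤b → contradiction (≤-trans b<k k≤b) 1+n≰n
  ... | inj₁ rd with last-neighbour i≤b (λ i<j j≤b → col i<j (m≤n⇒m≤1+n j≤b))
  ... | j , i≤j , j≤b , walk , reds = j , i≤j , m≤n⇒m≤1+n j≤b , walk , reds′
    where
    reds′ : ∀ k → j < k → k ≤ suc b → R (p i) (p k)
    reds′ k j<k k≤ with m≤n⇒m<n∨m≡n k≤
    ... | inj₁ (s≤s k≤b) = reds k j<k k≤b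
    ... | inj₂ refl      = rd

  -- The positions are recorded because `cover` prepends `i` to a clique found beyond the last blue
  -- neighbour of `i`, where every point is red to `i`.
  RedIn : ℕ → ℕ → ℕ → Set
  RedIn k i b = ∃ λ ys → length ys ≡ k × AllPairs R ys ×
                All (λ y → ∃ λ j → i ≤ j × j ≤ b × y ≡ p j) ys

  -- Jump from i to its last blue neighbour j and walk one unit: i is red to all of the
  -- remaining points, so they contain no red clique of one size less.
  cover : ∀ {g} n {i b} → i ≤ b → Coloured b → (∀ k → k < b → Walk B (p k) (p (suc k)) g) →
    RedIn (2 + n) i b ⊎
    ∃₂ λ δ e → δ ≤ n × e ≤ suc n × Walk B (p i) (p b) (δ * g + e)
  cover n {i} {b} i≤b col unit with last-neighbour i≤b col
  ... | j , i≤j , j≤b , (e , e≤1 , w) , reds with m≤n⇒m<n∨m≡n j≤b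
  ... | inj₂ refl = inj₂ (0 , e , z≤n , ≤-trans e≤1 (s≤s z≤n) , w)
  -- The point `b` lies beyond the last blue neighbour of `i`, so the two form a red pair.
  cover zero {i} {b} _ _ _ | j , i≤j , j≤b , _ , reds | inj₁ j<b =
    inj₁ (p i ∷ p b ∷ [] , refl , (reds b j<b ≤-refl ∷ []) ∷ [] ∷ [] ,
          (i , ≤-refl , ≤-trans i≤j j≤b , refl) ∷ (b , ≤-trans i≤j j≤b , ≤-refl , refl) ∷ [])
  cover {g} (suc n) {i} {b} _ col unit | j , i≤j , j≤b , (e , e≤1 , w) , reds | inj₁ j<b
    with cover n j<b col unit
  ... | inj₁ (ys , len , pairs , ins) =
    inj₁ (p i ∷ ys , cong suc len ,
          All.map (λ { (k , j<k , k≤b , refl) → reds k j<k k≤b }) ins ∷ pairs ,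
          (i , ≤-refl , ≤-trans i≤j j≤b , refl) ∷
          All.map (λ { (k , j<k , k≤b , eq) → k , ≤-trans i≤j (<⇒≤ j<k) , k≤b , eq }) ins)
  ... | inj₂ (δ , e′ , δ≤n , e′≤ , w′) =
    inj₂ (suc δ , e + e′ , s≤s δ≤n , +-mono-≤ e≤1 e′≤ ,
          subst (Walk B (p i) (p b)) (eq e g (δ * g) e′) (w ⊙ (unit j j<b ⊙ w′)))
    where
    eq : ∀ e g x e′ → e + (g + (x + e′)) ≡ (g + x) + (e + e′)
    eq = solve-∀

  straight : ∀ {b g} → (∀ k → k < b → Walk B (p k) (p (suc k)) g) →
             ∀ i L → i + L ≤ b → Walk B (p i) (p (i + L)) (L * g)
  straight unit i zero    _  = subst (λ k → Walk B (p i) (p k) 0) (sym (+-identityʳ i)) done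
  straight {g = g} unit i (suc L) le =
    subst (λ k → Walk B (p i) (p k) (suc L * g)) (sym (+-suc i L))
      (unit i (≤-trans (s≤s (m≤m+n i L)) le′) ⊙ straight unit (suc i) L le′)
    where
    le′ = ≤-trans (≤-reflexive (sym (+-suc i L))) le

  -- Cut the grid into w windows of q = suc n units. A window whose cover costs δ units can
  -- be shortened by q ∸ δ units (up to at most q extra edges); cnt δ counts these windows.
  Savings : (n g w : ℕ) → Set
  Savings n g w = ∃ λ cnt → w ≤ sumTo cnt (suc n) ×
    (∀ δ j → δ ≤ n → j ≤ cnt δ → ∃₂ λ E L → E ≤ j * suc n ×
       Walk B (p 0) (p (w * suc n)) L × L + j * ((suc n ∸ δ) * g) ≡ w * suc n * g + E)

  -- Induction on the number of windows, with the new one appended at the far end: either `cover`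
  -- finds a red clique in it, or it raises the count of the cost `δ₀` by one.
  windows : ∀ {g} n w → Coloured (w * suc n) →
            (∀ k → k < w * suc n → Walk B (p k) (p (suc k)) g) →
            (∃ λ ys → length ys ≡ 2 + n × AllPairs R ys) ⊎ Savings n g w
  windows n zero _ _ = inj₂ ((λ _ → 0) , z≤n , λ { δ zero _ z≤n → 0 , 0 , z≤n , done , refl })
  windows {g} n (suc w) col unit
    with windows {g} n w (λ i<j j≤ → col i<j (≤-trans j≤ (m≤n+m _ _)))
                   (λ k k< → unit k (≤-trans k< (m≤n+m _ _)))
       | cover {g} n (m≤n+m (w * suc n) (suc n)) col unit
  ... | inj₁ clique | _ = inj₁ clique
  ... | inj₂ _ | inj₁ (ys , len , pairs , _) = inj₁ (ys , len , pairs)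
  ... | inj₂ (cnt , w≤ , walks) | inj₂ (δ₀ , e , δ₀≤n , e≤ , new) =
    inj₂ (bump δ₀ cnt , ≤-trans (s≤s w≤) (sumTo-bump cnt (s≤s δ₀≤n)) , walks′)
    where
    q = suc n

    plain : Walk B (p (w * q)) (p (q + w * q)) (q * g)
    plain = subst (λ k → Walk B (p (w * q)) (p k) (q * g)) (+-comm (w * q) q)
              (straight unit (w * q) q (≤-reflexive (+-comm (w * q) q)))

    plain-eq : ∀ L c x y E → L + x ≡ y * g + E → L + c * g + x ≡ (c + y) * g + E
    plain-eq L c x y E eq = trans (lem₁ L (c * g) x) (trans (cong (_+ c * g) eq) (lem₂ y g E c))
      where
      lem₁ : ∀ L c x → L + c + x ≡ L + x + c
      lem₁ = solve-∀
      lem₂ : ∀ y g E c → y * g + E + c * g ≡ (c + y) * g + E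
      lem₂ = solve-∀

    used-eq : ∀ δ ℓ L e j y E → L + j * (ℓ * g) ≡ y * g + E →
              L + (δ * g + e) + suc j * (ℓ * g) ≡ (δ + ℓ + y) * g + (e + E)
    used-eq δ ℓ L e j y E eq =
      trans (lem₁ L δ g e (ℓ * g) j) (trans (cong (_+ (δ * g + e + ℓ * g)) eq) (lem₂ y g E δ e ℓ))
      where
      lem₁ : ∀ L δ g e x j → L + (δ * g + e) + (x + j * x) ≡ L + j * x + (δ * g + e + x)
      lem₁ = solve-∀
      lem₂ : ∀ y g E δ e ℓ → y * g + E + (δ * g + e + ℓ * g) ≡ (δ + ℓ + y) * g + (e + E)
      lem₂ = solve-∀

    walks′ : ∀ δ j → δ ≤ n → j ≤ bump δ₀ cnt δ → ∃₂ λ E L → E ≤ j * q ×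
      Walk B (p 0) (p (q + w * q)) L × L + j * ((q ∸ δ) * g) ≡ (q + w * q) * g + E
    -- If the earlier windows already supply `j` savings, the new one is crossed by unit steps.
    -- Otherwise `δ` is `δ₀`, and the new window supplies the last saving.
    walks′ δ j δ≤n j≤ with j ≤? cnt δ
    ... | yes j≤cnt with walks δ j δ≤n j≤cnt
    ...   | E , L , E≤ , walk , eq =
      E , L + q * g , E≤ , walk ⊙ plain , plain-eq L q (j * ((q ∸ δ) * g)) (w * q) E eq
    walks′ δ j δ≤n j≤ | no j≰cnt with δ ≟ δ₀ | j | j≤
    ...   | no _     | _       | j≤′     = contradiction j≤′ j≰cnt
    ...   | yes _    | zero    | _       = contradiction z≤n j≰cnt
    ...   | yes refl | suc j′  | s≤s j′≤ with walks δ j′ δ≤n j′≤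
    ...     | E , L , E≤ , walk , eq =
      e + E , L + (δ * g + e) , +-mono-≤ e≤ E≤ , walk ⊙ new ,
      trans (used-eq δ (q ∸ δ) L e j′ (w * q) E eq)
            (cong (λ k → (k + w * q) * g + (e + E)) (m+[n∸m]≡n (m≤n⇒m≤1+n δ≤n)))

-- Playing the game

_≟ᶜ_ : DecidableEquality Colour
red  ≟ᶜ red  = yes refl
red  ≟ᶜ blue = no λ ()
blue ≟ᶜ red  = no λ ()
blue ≟ᶜ blue = yes refl

open DecMembership (×-≡-dec _≟_ (×-≡-dec _≟_ _≟ᶜ_)) using (_∈?_)

BuilderWins-suc : BuilderWins G H t h → BuilderWins G H (suc t) h
BuilderWins-suc (ended e)            = ended e
BuilderWins-suc (move a b a<b new s) = move a b a<b new (BuilderWins-suc ∘ s)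

-- Follow the strategy for `F` until a blue copy appears, then switch. Turns left over are given
-- away, and `next` must cope with any position containing the copy.
BuilderWins-then : ∀ {F c} → BuilderWins G F t h →
                   (∀ {h′} → MonoCopy F blue h′ → BuilderWins G H c h′) →
                   BuilderWins G H (t + c) h
BuilderWins-then (ended (redG copy))    _    = ended (redG copy)
BuilderWins-then {t = zero}  (ended (blueH copy)) next = next copy
BuilderWins-then {t = suc t} (ended (blueH copy)) next =
  BuilderWins-suc (BuilderWins-then {t = t} (ended (blueH copy)) next)
BuilderWins-then (move a b a<b new s)   next =
  move a b a<b new (λ c → BuilderWins-then (s c) next)

Drawn : History → ℕ → ℕ → Set
Drawn h a b = ∃ λ c → (a , b , c) ∈ h

-- An edge may not be drawn twice; if it is already present, its colour is known and the turn is
-- given away. The continuation quantifies over later histories, so it covers both answers of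
-- Painter.
draw-edge : ∀ {a b} → a < b → (∀ {h′} → h ⊆ h′ → Drawn h′ a b → BuilderWins G H t h′) →
            BuilderWins G H (suc t) h
draw-edge {h} {a = a} {b} a<b next with (a , b , red) ∈? h | (a , b , blue) ∈? h
... | yes r | _     = BuilderWins-suc (next id (red , r))
... | no _  | yes b = BuilderWins-suc (next id (blue , b))
... | no ¬r | no ¬b = move a b a<b (λ { red → ¬r ; blue → ¬b }) (λ c → next there (c , here refl))

draw-star : ∀ (f : ℕ → ℕ) {b} k → (∀ i → i < k → f i < b) →
            (∀ {h′} → h ⊆ h′ → (∀ i → i < k → Drawn h′ (f i) b) → BuilderWins G H t h′) →
            BuilderWins G H (k + t) h
draw-star f zero    _  next = next id (λ _ ())
draw-star f {b} (suc k) lt next =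
  draw-edge (lt k ≤-refl) λ {h₁} s₁ (c , last) →
  draw-star f k (λ i i<k → lt i (m≤n⇒m≤1+n i<k)) λ {h₂} s₂ drawn →
  next (s₂ ∘ s₁) λ i i<1+k → extend h₂ (s₂ last) drawn i i<1+k
  where
  extend : ∀ {c} h₂ → (f k , b , c) ∈ h₂ → (∀ i → i < k → Drawn h₂ (f i) b) →
           ∀ i → i < suc k → Drawn h₂ (f i) b
  extend h₂ last drawn i (s≤s i≤k) with m≤n⇒m<n∨m≡n i≤k
  ... | inj₁ i<k  = drawn i i<k
  ... | inj₂ refl = _ , last

StrictMono : (ℕ → ℕ) → Set
StrictMono f = ∀ {i j} → i < j → f i < f j

-- The binomial coefficient `k` over 2.
pairs : ℕ → ℕ
pairs zero    = 0
pairs (suc k) = k + pairs k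

draw-complete : ∀ (f : ℕ → ℕ) → StrictMono f → ∀ k →
  (∀ {h′} → h ⊆ h′ → (∀ {i j} → i < j → j < k → Drawn h′ (f i) (f j)) → BuilderWins G H t h′) →
  BuilderWins G H (pairs k + t) h
draw-complete f mono zero    next = next id (λ _ ())
draw-complete {h} {G} {H} {t} f mono (suc k) next =
  subst (λ u → BuilderWins G H u h) (sym (+-assoc k (pairs k) t))
    (draw-star f k (λ i → mono) λ {h₁} s₁ star →
     draw-complete f mono k λ {h₂} s₂ drawn →
     next (s₂ ∘ s₁) λ i<j j<1+k →
       extend h₂ (λ i i<k → let c , e = star i i<k in c , s₂ e) drawn i<j j<1+k)
  where
  extend : ∀ h₂ → (∀ i → i < k → Drawn h₂ (f i) (f k)) →
           (∀ {i j} → i < j → j < k → Drawn h₂ (f i) (f j)) →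
           ∀ {i j} → i < j → j < suc k → Drawn h₂ (f i) (f j)
  extend h₂ star drawn i<j (s≤s j≤k) with m≤n⇒m<n∨m≡n j≤k
  ... | inj₁ j<k  = drawn i<j j<k
  ... | inj₂ refl = star _ i<j

-- Copies in the drawn graph

-- Vertices are addressed by their index along `v`, so that differences of indices count path edges.
Arrow : (ℕ → ℕ) → Colour → History → ℕ → ℕ → Set
Arrow v c h x y = x < y × (v x , v y , c) ∈ h

-- A monochromatic complete graph contains every ordered graph with at most as many vertices; the
-- first `size H` members serve.
clique⇒copy : ∀ {v c ys} → StrictMono v → size H ≤ length ys → AllPairs (Arrow v c h) ys → MonoCopy H c h
clique⇒copy {H} {h} {v} {c} {ys} mono le pairs =
  (λ i → v (f i)) , (λ i j → mono ∘ proj₁ ∘ arrow i j) , (λ i j i<j _ → proj₂ (arrow i j i<j))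
  where
  f : Fin (size H) → ℕ
  f i = lookup ys (inject≤ i le)
  arrow : ∀ i j → toℕ i < toℕ j → Arrow v c h (f i) (f j)
  arrow i j i<j = AllPairs-lookup pairs (inject≤ i le) (inject≤ j le)
    (subst₂ _<_ (sym (toℕ-inject≤ i le)) (sym (toℕ-inject≤ j le)) i<j)

at : ∀ {B : Rel ℕ 0ℓ} {x y L} → Walk B x y L → Fin (suc L) → ℕ
at {x = x} w          zero    = x
at         (step _ w) (suc i) = at w i

at-last : ∀ {B : Rel ℕ 0ℓ} {x y L} (w : Walk B x y L) i → toℕ i ≡ L → at w i ≡ y
at-last done       zero    _  = refl
at-last (step _ w) (suc i) eq = at-last w i (suc-injective eq)

at-step : ∀ {B : Rel ℕ 0ℓ} {x y L} (w : Walk B x y L) i j → suc (toℕ i) ≡ toℕ j → B (at w i) (at w j)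
at-step (step b w) zero    (suc zero) _  = b
at-step (step _ w) (suc i) (suc j)    eq = at-step w i j (suc-injective eq)

at-mono : ∀ {B : Rel ℕ 0ℓ} {x y L} → (∀ {x y} → B x y → x < y) → (w : Walk B x y L) →
          ∀ i j → toℕ i < toℕ j → at w i < at w j
at-mono lt (step b w) zero    (suc zero)        _         = lt b
at-mono lt (step b w) zero    (suc j@(suc _))   _         = <-trans (lt b) (at-mono lt w zero j (s≤s z≤n))
at-mono lt (step _ w) (suc i) (suc j)           (s≤s i<j) = at-mono lt w i j i<j

-- The walk supplies the consecutive edges, and the arrow from `x` to `y` the edge between the first
-- and the last vertex.
closed-walk⇒cycle : ∀ {v x y d} → StrictMono v → Walk (Arrow v blue h) x y d → Arrow v blue h x y →
                    MonoCopy (Cycle (suc d)) blue h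
closed-walk⇒cycle {h} {v} {x} {y} {d} mono w (_ , long) =
  (λ i → v (at w i)) , (λ i j → mono ∘ at-mono proj₁ w i j) , edge
  where
  edge : ∀ i j → toℕ i < toℕ j → adj (Cycle (suc d)) i j ≡ true → (v (at w i) , v (at w j) , blue) ∈ h
  edge i j _ adjacent with Equivalence.to (T-∨ {suc (toℕ i) ≡ᵇ toℕ j}) (Equivalence.from T-≡ adjacent)
  ... | inj₁ consecutive = proj₂ (at-step w i j (≡ᵇ⇒≡ _ _ consecutive))
  ... | inj₂ ends with Equivalence.to (T-∧ {toℕ i ≡ᵇ 0} {toℕ j ≡ᵇ d}) ends
  edge zero j _ _ | inj₂ _ | _ , j-last =
    subst (λ z → (v x , v z , blue) ∈ h) (sym (at-last w j (suc-injective (≡ᵇ⇒≡ _ _ j-last)))) long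

-- Past the end of the path, `v` continues through consecutive integers. Being total, it lets
-- Builder also use indices beyond a short path.
extend-path : ∀ {M} → MonoCopy (Path (suc M)) blue h →
              ∃ λ v → StrictMono v × (∀ i → i < M → (v i , v (suc i) , blue) ∈ h)
extend-path {h} {M} (f , f-mono , f-edge) = v , mono , edge
  where
  clamp : ℕ → Fin (suc M)
  clamp i = fromℕ< (s≤s (m⊓n≤n i M))

  toℕ-clamp : ∀ {i} → i ≤ M → toℕ (clamp i) ≡ i
  toℕ-clamp {i} i≤M = trans (toℕ-fromℕ< _) (m≤n⇒m⊓n≡m i≤M)

  clamp-≥ : ∀ {i} → M ≤ i → clamp i ≡ clamp M
  clamp-≥ {i} M≤i = toℕ-injective (trans (toℕ-fromℕ< _) (trans (m≥n⇒m⊓n≡n M≤i) (sym (toℕ-clamp ≤-refl))))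

  v : ℕ → ℕ
  v i = f (clamp i) + (i ∸ M)

  v-≤ : ∀ {i} → i ≤ M → v i ≡ f (clamp i)
  v-≤ {i} i≤M = trans (cong (f (clamp i) +_) (m≤n⇒m∸n≡0 i≤M)) (+-identityʳ _)

  consecutive : ∀ {i} → i < M → suc (toℕ (clamp i)) ≡ toℕ (clamp (suc i))
  consecutive i<M = trans (cong suc (toℕ-clamp (<⇒≤ i<M))) (sym (toℕ-clamp i<M))

  v-suc : ∀ i → v i < v (suc i)
  v-suc i with i <? M
  ... | yes i<M = subst₂ _<_ (sym (v-≤ (<⇒≤ i<M))) (sym (v-≤ i<M))
                    (f-mono _ _ (≤-reflexive (consecutive i<M)))
  ... | no i≮M  = subst₂ (λ a b → f a + (i ∸ M) < f b + (suc i ∸ M))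
                    (sym (clamp-≥ M≤i)) (sym (clamp-≥ (m≤n⇒m≤1+n M≤i)))
                    (+-monoʳ-< _ (≤-reflexive (sym (+-∸-assoc 1 M≤i))))
    where M≤i = ≮⇒≥ i≮M

  mono : StrictMono v
  mono {i} {suc j} (s≤s i≤j) with m≤n⇒m<n∨m≡n i≤j
  ... | inj₁ i<j  = <-trans (mono i<j) (v-suc j)
  ... | inj₂ refl = v-suc i

  edge : ∀ i → i < M → (v i , v (suc i) , blue) ∈ h
  edge i i<M = subst₂ (λ a b → (a , b , blue) ∈ h) (sym (v-≤ (<⇒≤ i<M))) (sym (v-≤ i<M))
    (f-edge _ _ (≤-reflexive (consecutive i<M))
      (Equivalence.to T-≡ (≡⇒≡ᵇ _ _ (consecutive i<M))))

-- The second equation places gadget, windows, plain piece and last grid end to end under the chord.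
-- The first is the edge budget of the walk: `C` remains for the adjustable edges of the gadget and
-- the stray blue edges, once savings and plain steps of the last grid cancel.
Layout : (ρ C₀ m u d D pad : ℕ) → Set
Layout ρ C₀ m u d D pad = ∃ λ g → ∃₂ λ C P → 0 < g × C₀ ≤ C × C ≤ C₀ + m ×
  P + pad + u * g + C ≡ d × ρ + u * g + P + m * g ≡ D

-- g is the least number with m * g > Y + C₀, where Y = D + pad ∸ d ∸ ρ; the excess r ≤ m goes into C.
layout : ∀ n ρ C₀ m u d D pad .{{_ : NonZero m}} →
  2 * suc n * u ≤ m → 2 * ρ + 3 * (C₀ + m) ≤ d → 2 * d ≤ D → D ≤ d * suc n → pad ≤ ρ →
  Layout ρ C₀ m u d D pad
layout n ρ C₀ m u d D pad 2qu≤m large 2d≤D D≤dq pad≤ρ =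
  g , C , proj₁ rest , s≤s z≤n , m≤m+n C₀ _ , C≤K , fits , fills
  where
  q = suc n
  K = C₀ + m

  ρ≤d : ρ ≤ d
  ρ≤d = ≤-trans (m≤m+n ρ (ρ + 0)) (≤-trans (m≤m+n (2 * ρ) (3 * K)) large)

  d+ρ≤D+pad : d + ρ ≤ D + pad
  d+ρ≤D+pad = ≤-trans (+-monoʳ-≤ d (≤-trans ρ≤d (m≤m+n d 0))) (≤-trans 2d≤D (m≤m+n D pad))

  -- Since `D` is at least `2 * d` and `d` at least `ρ`, nothing is truncated in `Y`.
  gap = m≤n⇒∃[o]m+o≡n d+ρ≤D+pad
  Y = proj₁ gap

  Y-eq : d + ρ + Y ≡ D + pad
  Y-eq = proj₂ gap

  r = m ∸ (Y + C₀) % m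
  g = suc ((Y + C₀) / m)
  C = C₀ + r

  C≤K : C ≤ K
  C≤K = +-monoʳ-≤ C₀ (m∸n≤m m ((Y + C₀) % m))

  mg≡Y+C : m * g ≡ Y + C
  mg≡Y+C = begin
    m * suc ((Y + C₀) / m)                            ≡⟨ *-suc m _ ⟩
    m + m * ((Y + C₀) / m)                            ≡⟨ cong (_+ m * ((Y + C₀) / m)) (sym (m∸n+n≡m (m%n≤n (Y + C₀) m))) ⟩
    r + (Y + C₀) % m + m * ((Y + C₀) / m)             ≡⟨ +-assoc r _ _ ⟩
    r + ((Y + C₀) % m + m * ((Y + C₀) / m))           ≡⟨ cong (λ x → r + ((Y + C₀) % m + x)) (*-comm m _) ⟩
    r + ((Y + C₀) % m + (Y + C₀) / m * m)             ≡⟨ cong (r +_) (sym (m≡m%n+[m/n]*n (Y + C₀) m)) ⟩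
    r + (Y + C₀)                                      ≡⟨ trans (+-comm r _) (+-assoc Y C₀ r) ⟩
    Y + (C₀ + r)                                      ∎
    where open ≡-Reasoning

  Y≤dq : Y ≤ d * q
  Y≤dq = +-cancelˡ-≤ (d + ρ) Y (d * q) (begin
    d + ρ + Y         ≡⟨ Y-eq ⟩
    D + pad           ≤⟨ +-mono-≤ D≤dq pad≤ρ ⟩
    d * q + ρ         ≡⟨ +-comm _ ρ ⟩
    ρ + d * q         ≤⟨ +-monoˡ-≤ (d * q) (m≤n+m ρ d) ⟩
    d + ρ + d * q     ∎)
    where open ≤-Reasoning

  -- After multiplication by `2 * q`, the term in `u * g` is at most `m * g`, that is `Y + C`, hence
  -- at most `d * q + q * K`. By `large`, all other terms and this `q * K` sum to at most `q * d`.
  room : pad + u * g + C ≤ d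
  room = *-cancelˡ-≤ (2 * q) (begin
    2 * q * (pad + u * g + C)
      ≡⟨ lem₁ q pad (u * g) C ⟩
    2 * q * pad + 2 * q * (u * g) + 2 * q * C
      ≡⟨ cong (λ x → 2 * q * pad + x + 2 * q * C) (sym (*-assoc (2 * q) u g)) ⟩
    2 * q * pad + 2 * q * u * g + 2 * q * C
      ≤⟨ +-mono-≤ (+-mono-≤ (*-monoʳ-≤ (2 * q) pad≤ρ) (*-monoˡ-≤ g 2qu≤m))
                  (*-monoʳ-≤ (2 * q) C≤K) ⟩
    2 * q * ρ + m * g + 2 * q * K
      ≡⟨ cong (λ x → 2 * q * ρ + x + 2 * q * K) mg≡Y+C ⟩
    2 * q * ρ + (Y + C) + 2 * q * K
      ≤⟨ +-monoˡ-≤ (2 * q * K) (+-monoʳ-≤ (2 * q * ρ)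
           (+-mono-≤ Y≤dq (≤-trans C≤K (m≤m+n K (n * K))))) ⟩
    2 * q * ρ + (d * q + q * K) + 2 * q * K
      ≡⟨ lem₂ q ρ K d ⟩
    q * (2 * ρ + 3 * K) + d * q
      ≤⟨ +-monoˡ-≤ (d * q) (*-monoʳ-≤ q large) ⟩
    q * d + d * q
      ≡⟨ lem₃ q d ⟩
    2 * q * d ∎)
    where
    open ≤-Reasoning
    lem₁ : ∀ q a b c → 2 * q * (a + b + c) ≡ 2 * q * a + 2 * q * b + 2 * q * c
    lem₁ = solve-∀
    lem₂ : ∀ q ρ K d → 2 * q * ρ + (d * q + q * K) + 2 * q * K ≡ q * (2 * ρ + 3 * K) + d * q
    lem₂ = solve-∀
    lem₃ : ∀ q d → q * d + d * q ≡ 2 * q * d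
    lem₃ = solve-∀

  rest = m≤n⇒∃[o]m+o≡n room
  P = proj₁ rest

  fits : P + pad + u * g + C ≡ d
  fits = trans (lem P pad (u * g) C) (proj₂ rest)
    where
    lem : ∀ P a b c → P + a + b + c ≡ a + b + c + P
    lem = solve-∀

  fills : ρ + u * g + P + m * g ≡ D
  fills = +-cancelʳ-≡ pad _ D (begin
    ρ + u * g + P + m * g + pad       ≡⟨ cong (λ x → ρ + u * g + P + x + pad) mg≡Y+C ⟩
    ρ + u * g + P + (Y + C) + pad     ≡⟨ lem ρ (u * g) P Y C pad ⟩
    P + pad + u * g + C + ρ + Y       ≡⟨ cong (λ x → x + ρ + Y) fits ⟩
    d + ρ + Y                         ≡⟨ Y-eq ⟩
    D + pad                           ∎)
    where
    open ≡-Reasoning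
    lem : ∀ ρ x P Y C a → ρ + x + P + (Y + C) + a ≡ P + a + x + C + ρ + Y
    lem = solve-∀

-- Builder's strategy once the blue path is drawn

∣! : ∀ {k n} → suc k ≤ n → suc k ∣ n !
∣! {k} k<n = ∣-trans (m∣m*n (k !)) (m≤n⇒m!∣n! k<n)

-- Λ is a multiple of every possible saving of a window, J bounds the number of windows used,
-- u and b are the lengths of the two grids in units, K is the number of lengths offered by the
-- gadget, and for d < D₀ a blue clique of size D₀ already contains the cycle.
module Strategy (n : ℕ) where

  q N Λ J u b C₀ m K ρ D₀ cost : ℕ
  q = suc n
  N = 2 + n
  Λ = q !
  J = n * Λ
  -- There are `q * J` windows of `q` units: with `q` possible costs, some cost occurs at least `J`
  -- times.
  u = q * J * q
  -- Makes `m` at least `2 * q * u`, as `layout` requires.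
  b = suc (2 * q * u)
  -- Stray edges number at most `q` in the last grid and `J * q` in the windows; one more keeps the
  -- gadget's share positive.
  C₀ = suc (q + J * q)
  m = b * Λ
  K = C₀ + m
  -- A blue clique on `suc K` points offers every number of edges from 1 to `K`.
  ρ = ramsey N (suc K)
  D₀ = 2 * ρ + 3 * K
  cost = pairs (ramsey N D₀) + (pairs N + (pairs ρ + (pairs (suc u) + (pairs (suc b) + 0))))

  instance
    Λ≢0 : NonZero Λ
    Λ≢0 = q !≢0

    m≢0 : NonZero m
    m≢0 = m*n≢0 b Λ

  2qu≤m : 2 * q * u ≤ m
  2qu≤m = ≤-trans (n≤1+n _) (m≤m*n b Λ)

  -- Each of the `δ` plain steps of length `Λ * g` is paid for by `c` windows saving `suc k` units
  -- apiece.
  turns≤J : ∀ c {k δ} → Λ ≡ c * suc k → δ ≤ n → δ * c ≤ J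
  turns≤J c {k} Λ≡ δ≤n = *-mono-≤ δ≤n (≤-trans (m≤m*n c (suc k)) (≤-reflexive (sym Λ≡)))

  module _ {G : OrdGraph} (small : size G ≤ N) (d : ℕ) {v : ℕ → ℕ} (mono : StrictMono v) where

    Red Blue : History → ℕ → ℕ → Set
    Red = Arrow v red
    Blue = Arrow v blue

    Win : ℕ → History → Set
    Win = BuilderWins G (Cycle (suc d))

    PathIn : History → Set
    PathIn h = ∀ i → i < d * q → (v i , v (suc i) , blue) ∈ h

    red-wins : ∀ {ys} → length ys ≡ N → AllPairs (Red h) ys → Win t h
    red-wins len reds = ended (redG (clique⇒copy mono (≤-trans small (≤-reflexive (sym len))) reds))

    cycle-wins : ∀ {x y} → Walk (Blue h) x y d → Blue h x y → Win t h
    cycle-wins walk long = ended (blueH (closed-walk⇒cycle mono walk long))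

    arrow : ∀ {x y} → x < y → Drawn h (v x) (v y) → Red h x y ⊎ Blue h x y
    arrow x<y (red  , e) = inj₁ (x<y , e)
    arrow x<y (blue , e) = inj₂ (x<y , e)

    Blue-mono : ∀ {x y} → h ⊆ h′ → Blue h x y → Blue h′ x y
    Blue-mono s (x<y , e) = x<y , s e

    segment : PathIn h → ∀ x L → x + L ≤ d * q → Walk (Blue h) x (x + L) L
    segment {h} path x L le = subst (Walk (Blue h) x (x + L)) (*-identityʳ L)
      (Grid.straight (Red h) (Blue h) id (λ i i< → step (≤-refl , path i i<) done) x L le)

    segment-to : PathIn h → ∀ {x y} → (x≤y : x ≤ y) → y ≤ d * q → Walk (Blue h) x y (y ∸ x)
    segment-to {h} path {x} {y} x≤y y≤ = subst (λ z → Walk (Blue h) x z (y ∸ x)) (m+[n∸m]≡n x≤y)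
      (segment path x (y ∸ x) (≤-trans (≤-reflexive (m+[n∸m]≡n x≤y)) y≤))

    point : ℕ → ℕ → ℕ → ℕ
    point s g i = s + i * g

    point-mono : ∀ s {g} → 0 < g → StrictMono (point s g)
    point-mono s {suc g} _ i<j = +-monoʳ-< s (*-monoˡ-< (suc g) i<j)

    point-unit : PathIn h → ∀ s g k → s + k * g ≤ d * q →
                 ∀ i → i < k → Walk (Blue h) (point s g i) (point s g (suc i)) g
    point-unit {h} path s g k le i i<k = subst (λ z → Walk (Blue h) (point s g i) z g) eq
      (segment path (point s g i) g (≤-trans (≤-reflexive eq) (≤-trans (+-monoʳ-≤ s (*-monoˡ-≤ g i<k)) le)))
      where
      eq : s + i * g + g ≡ s + (g + i * g)
      eq = trans (+-assoc s _ g) (cong (s +_) (+-comm (i * g) g))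

    Coloured : History → (ℕ → ℕ) → ℕ → Set
    Coloured h p k = Grid.Coloured (Red h) (Blue h) p k

    Coloured-mono : ∀ {p k} → h ⊆ h′ → Coloured h p k → Coloured h′ p k
    Coloured-mono s col i<j j≤ with col i<j j≤
    ... | inj₁ (x<y , e) = inj₁ (x<y , s e)
    ... | inj₂ (x<y , e) = inj₂ (x<y , s e)

    draw-grid : ∀ (p : ℕ → ℕ) → StrictMono p → ∀ k →
      (∀ {h′} → h ⊆ h′ → (∀ {i j} → i < j → j < k → Red h′ (p i) (p j) ⊎ Blue h′ (p i) (p j)) → Win t h′) →
      Win (pairs k + t) h
    draw-grid p p-mono k next = draw-complete (v ∘ p) (mono ∘ p-mono) k λ s drawn →
      next s (λ i<j j<k → arrow (p-mono i<j) (drawn i<j j<k))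

    module Long {s D : ℕ} (2d≤D : 2 * d ≤ D) (D≤ : s + D ≤ d * q) (D₀≤d : D₀ ≤ d) where

      -- The freedom in f absorbs the bounded number of extra edges on the rest of the walk.
      Gadget : History → Set
      Gadget h = ∃ λ pad → pad ≤ ρ × (∀ f → 0 < f → f ≤ K → Walk (Blue h) s (s + ρ) (pad + f))

      end : ∀ g P → ρ + u * g + P + m * g ≡ D → s + ρ + u * g + P + b * (Λ * g) ≡ s + D
      end g P fills = trans (lem s ρ (u * g) P (b * (Λ * g)))
        (cong (s +_) (trans (cong (ρ + u * g + P +_) (sym (*-assoc b Λ g))) fills))
        where
        lem : ∀ s ρ x P y → s + ρ + x + P + y ≡ s + (ρ + x + P + y)
        lem = solve-∀

      -- As `Λ` is `c * (q ∸ δ′)`, saving in `δ * c` windows cancels the `δ` plain steps of the last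
      -- grid exactly. The stray edges `E + e` stay below `C`, and the gadget contributes the
      -- difference `f`.
      closing-walk : ∀ {pad g C P δ δ′ c e E L} → PathIn h →
        (∀ f → 0 < f → f ≤ K → Walk (Blue h) s (s + ρ) (pad + f)) →
        C₀ ≤ C → C ≤ K → P + pad + u * g + C ≡ d → ρ + u * g + P + m * g ≡ D →
        δ ≤ n → δ′ ≤ n → Λ ≡ c * suc (n ∸ δ′) →
        e ≤ q → E ≤ δ * c * q → L + δ * c * ((q ∸ δ′) * g) ≡ u * g + E →
        Walk (Blue h) (s + ρ) (s + ρ + u * g) L →
        Walk (Blue h) (s + ρ + u * g + P) (s + D) (δ * (Λ * g) + e) →
        Walk (Blue h) s (s + D) d
      closing-walk {h} {pad} {g} {C} {P} {δ} {δ′} {c} {e} {E} {L}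
        path gadget C₀≤C C≤K fits fills δ≤n δ′≤n Λ≡cℓ e≤q E≤ saved window cover =
        subst (Walk (Blue h) s (s + D)) total
          (gadget f (m<n⇒0<n∸m E+e<C) (≤-trans (m∸n≤m C (E + e)) C≤K)
           ⊙ (window ⊙ (segment path (s + ρ + u * g) P x₃≤ ⊙ cover)))
        where
        x₃≤ : s + ρ + u * g + P ≤ d * q
        x₃≤ = ≤-trans (m≤m+n _ _) (≤-trans (≤-reflexive (end g P fills)) D≤)

        E+e<C : E + e < C
        E+e<C = ≤-trans (s≤s (≤-trans (+-mono-≤ (≤-trans E≤ (*-monoˡ-≤ q (turns≤J c Λ≡cℓ δ≤n))) e≤q)
                                      (≤-reflexive (+-comm (J * q) q)))) C₀≤C

        f = C ∸ (E + e)

        saved′ : L + δ * (Λ * g) ≡ u * g + E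
        saved′ = trans (cong (L +_) eq) saved
          where
          lem : ∀ δ c ℓ g → δ * (c * ℓ * g) ≡ δ * c * (ℓ * g)
          lem = solve-∀
          eq : δ * (Λ * g) ≡ δ * c * ((q ∸ δ′) * g)
          eq = trans (cong (λ x → δ * (x * g)) (trans Λ≡cℓ (cong (c *_) (sym (+-∸-assoc 1 δ′≤n)))))
                     (lem δ c (q ∸ δ′) g)

        total : pad + f + (L + (P + (δ * (Λ * g) + e))) ≡ d
        total = begin
          pad + f + (L + (P + (δ * (Λ * g) + e)))   ≡⟨ lem₁ pad f L P (δ * (Λ * g)) e ⟩
          pad + f + P + e + (L + δ * (Λ * g))       ≡⟨ cong (pad + f + P + e +_) saved′ ⟩
          pad + f + P + e + (u * g + E)             ≡⟨ lem₂ pad f P e (u * g) E ⟩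
          P + pad + u * g + (f + (E + e))           ≡⟨ cong (P + pad + u * g +_) (m∸n+n≡m (<⇒≤ E+e<C)) ⟩
          P + pad + u * g + C                       ≡⟨ fits ⟩
          d                                         ∎
          where
          open ≡-Reasoning
          lem₁ : ∀ a f L P x e → a + f + (L + (P + (x + e))) ≡ a + f + P + e + (L + x)
          lem₁ = solve-∀
          lem₂ : ∀ a f P e x E → a + f + P + e + (x + E) ≡ P + a + x + (f + (E + e))
          lem₂ = solve-∀

      finish : ∀ {pad g C P} → PathIn h → Blue h s (s + D) →
        (∀ f → 0 < f → f ≤ K → Walk (Blue h) s (s + ρ) (pad + f)) →
        C₀ ≤ C → C ≤ K → P + pad + u * g + C ≡ d → ρ + u * g + P + m * g ≡ D →
        Coloured h (point (s + ρ) g) u →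
        Coloured h (point (s + ρ + u * g + P) (Λ * g)) b →
        Win t h
      finish {h} {t} {pad} {g} {C} {P} path long gadget C₀≤C C≤K fits fills col₁ col₂ =
        decide (Grid.windows (Red h) (Blue h) (point (s + ρ) g) n (q * J) col₁
                 (point-unit path (s + ρ) g u (≤-trans (m≤m+n x₂ P) (≤-trans (m≤m+n x₃ _) end≤))))
               (Grid.cover (Red h) (Blue h) (point x₃ (Λ * g)) n z≤n col₂
                 (point-unit path x₃ (Λ * g) b end≤))
        where
        x₂ = s + ρ + u * g
        x₃ = x₂ + P

        end≤ : x₃ + b * (Λ * g) ≤ d * q
        end≤ = ≤-trans (≤-reflexive (end g P fills)) D≤

        decide : (∃ λ ys → length ys ≡ N × AllPairs (Red h) ys) ⊎
                 Grid.Savings (Red h) (Blue h) (point (s + ρ) g) n g (q * J) →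
                 Grid.RedIn (Red h) (Blue h) (point x₃ (Λ * g)) N 0 b ⊎
                 (∃₂ λ δ e → δ ≤ n × e ≤ q ×
                    Walk (Blue h) (point x₃ (Λ * g) 0) (point x₃ (Λ * g) b) (δ * (Λ * g) + e)) →
                 Win t h
        decide (inj₁ (_ , len , reds)) _ = red-wins len reds
        decide (inj₂ _) (inj₁ (_ , len , reds , _)) = red-wins len reds
        decide (inj₂ (cnt , le , walks)) (inj₂ (δ , e , δ≤n , e≤q , cover)) =
          -- Some cost `δ′` is shared by at least `J` windows, of which `δ * c` are put to use.
          let δ′ , δ′≤n , J≤ = pigeonhole cnt J n le
              divides c Λ≡cℓ = ∣! {n ∸ δ′} {q} (s≤s (m∸n≤m n δ′))
              E , L , E≤ , window , saved = walks δ′ (δ * c) δ′≤n (≤-trans (turns≤J c Λ≡cℓ δ≤n) J≤)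
          in cycle-wins (closing-walk path gadget C₀≤C C≤K fits fills δ≤n δ′≤n Λ≡cℓ e≤q E≤ saved
               (subst (λ x → Walk (Blue h) x x₂ L) (+-identityʳ (s + ρ)) window)
               (subst₂ (λ x y → Walk (Blue h) x y (δ * (Λ * g) + e)) (+-identityʳ x₃) (end g P fills) cover))
               long

      -- A blue clique from `s + i` to `s + j` is entered and left along the path. These plain edges
      -- make up `pad`, and `i < j` bounds it by `ρ`.
      make-gadget : PathIn h →
        (∀ {i j} → i < j → j < ρ → Red h (s + i) (s + j) ⊎ Blue h (s + i) (s + j)) →
        (∃ λ ys → length ys ≡ N × AllPairs (Red h) ys) ⊎ Gadget h
      make-gadget {h} path col
        with ramsey-clique {xs = applyUpTo (s +_) ρ} N (suc K) (≤-reflexive (sym (length-applyUpTo (s +_) ρ)))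
               (applyUpTo⁺₁ (s +_) ρ col)
      ... | inj₁ (ys , _ , len , reds) = inj₁ (ys , len , reds)
      ... | inj₂ (x ∷ y ∷ ys , sub , len , blues@(xs< ∷ _)) with clique-walk x y ys blues
      ... | z , z∈ , walks
        with ∈-applyUpTo⁻ (s +_) (Sublist.lookup sub (here refl))
           | ∈-applyUpTo⁻ (s +_) (Sublist.lookup sub (there z∈))
      ... | i , i<ρ , refl | j , j<ρ , refl =
        inj₂ (i + (ρ ∸ j) , pad≤ρ , λ { (suc f) _ f<K →
          subst (Walk (Blue h) s (s + ρ)) (lem i (suc f) (ρ ∸ j))
          (segment path s i (≤-trans (+-monoʳ-≤ s (<⇒≤ i<ρ)) s+ρ≤)
           ⊙ (walks f (≤-trans (s≤s⁻¹ f<K) (≤-reflexive (sym K≡)))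
           ⊙ subst (Walk (Blue h) (s + j) (s + ρ)) ([m+n]∸[m+o]≡n∸o s ρ j)
               (segment-to path (+-monoʳ-≤ s (<⇒≤ j<ρ)) s+ρ≤))) })
        where
        K≡ : length ys ≡ q + J * q + m
        K≡ = suc-injective (suc-injective len)
        s+ρ≤ : s + ρ ≤ d * q
        s+ρ≤ = ≤-trans (+-monoʳ-≤ s (≤-trans (m≤m+n ρ _) (≤-trans (m≤m+n (2 * ρ) _)
                 (≤-trans D₀≤d (≤-trans (m≤m+n d _) 2d≤D))))) D≤
        pad≤ρ : i + (ρ ∸ j) ≤ ρ
        pad≤ρ = ≤-trans (+-monoˡ-≤ (ρ ∸ j) (<⇒≤ (+-cancelˡ-< s i j (proj₁ (All.lookup xs< z∈)))))
                  (≤-reflexive (m+[n∸m]≡n (<⇒≤ j<ρ)))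
        lem : ∀ a f c → a + (f + c) ≡ a + c + f
        lem = solve-∀

      win-with-gadget : PathIn h → Blue h s (s + D) → Gadget h → Win (pairs (suc u) + (pairs (suc b) + 0)) h
      win-with-gadget {h} path long (pad , pad≤ρ , gadget) =
        -- The spacing `g` depends on `pad`, hence on Painter's colours in the gadget, so the two
        -- grids are drawn only now.
        continue (layout n ρ C₀ m u d D pad 2qu≤m D₀≤d 2d≤D (≤-trans (m≤n+m D s) D≤) pad≤ρ)
        where
        continue : Layout ρ C₀ m u d D pad → Win (pairs (suc u) + (pairs (suc b) + 0)) h
        continue (g , C , P , 0<g , C₀≤C , C≤K , fits , fills) =
          draw-grid (point (s + ρ) g) (point-mono (s + ρ) 0<g) (suc u) λ s₁ col₁ →
          draw-grid (point x₃ (Λ * g)) (point-mono x₃ (*-mono-≤ (>-nonZero⁻¹ Λ) 0<g)) (suc b) λ s₂ col₂ →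
          finish (λ i → s₂ ∘ s₁ ∘ path i) (Blue-mono (s₂ ∘ s₁) long)
            (λ f 0<f f≤K → Walk-map (Blue-mono (s₂ ∘ s₁)) (gadget f 0<f f≤K)) C₀≤C C≤K fits fills
            (Coloured-mono s₂ λ i<j j≤u → col₁ i<j (s≤s j≤u)) (λ i<j j≤b → col₂ i<j (s≤s j≤b))
          where
          x₃ = s + ρ + u * g + P

      win-with-chord : PathIn h → Blue h s (s + D) →
                       Win (pairs ρ + (pairs (suc u) + (pairs (suc b) + 0))) h
      win-with-chord path long =
        draw-grid (s +_) (+-monoʳ-< s) ρ λ s₁ col →
        continue (λ i → s₁ ∘ path i) (Blue-mono s₁ long) col
        where
        continue : ∀ {h} → PathIn h → Blue h s (s + D) →
          (∀ {i j} → i < j → j < ρ → Red h (s + i) (s + j) ⊎ Blue h (s + i) (s + j)) →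
          Win (pairs (suc u) + (pairs (suc b) + 0)) h
        continue path long col with make-gadget path col
        ... | inj₁ (_ , len , reds) = red-wins len reds
        ... | inj₂ gadget           = win-with-gadget path long gadget

    win-long : D₀ ≤ d → PathIn h →
               Win (pairs N + (pairs ρ + (pairs (suc u) + (pairs (suc b) + 0)))) h
    win-long D₀≤d path = draw-grid (_* d) *d-mono N λ s col →
      continue (λ i → s ∘ path i) (allPairs-or-any (applyUpTo⁺₁ (_* d) N col))
      where
      *d-mono : StrictMono (_* d)
      *d-mono = *-monoˡ-< d {{>-nonZero (≤-trans (≤-trans (s≤s z≤n) (m≤n+m (3 * K) (2 * ρ))) D₀≤d)}}

      continue : PathIn h′ → AllPairs (Red h′) (applyUpTo (_* d) N) ⊎
                 (∃₂ λ x y → x ∈ applyUpTo (_* d) N × y ∈ applyUpTo (_* d) N × Blue h′ x y) →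
                 Win (pairs ρ + (pairs (suc u) + (pairs (suc b) + 0))) h′
      continue path (inj₁ reds) = red-wins (length-applyUpTo (_* d) N) reds
      continue {h′} path (inj₂ (x , y , x∈ , y∈ , chord))
        with ∈-applyUpTo⁻ (_* d) x∈ | ∈-applyUpTo⁻ (_* d) y∈
      ... | i , _ , refl | j , s≤s j≤q , refl with m≤n⇒∃[o]m+o≡n (*-cancelʳ-< d i j (proj₁ chord))
      ... | k , refl with k
      -- Here `j` is `suc i + k`: a chord over `d` path edges closes the cycle at once, and any
      -- other spans at least `2 * d`.
      ...   | zero   = cycle-wins (subst (λ z → Walk (Blue h′) (i * d) z d) eq
                         (segment path (i * d) d (≤-trans (≤-reflexive eq) jd≤))) chord
        where
        eq : i * d + d ≡ (suc i + 0) * d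
        eq = trans (+-comm _ d) (cong (_* d) (sym (+-identityʳ (suc i))))
        jd≤ : (suc i + 0) * d ≤ d * q
        jd≤ = ≤-trans (*-monoˡ-≤ d j≤q) (≤-reflexive (*-comm q d))
      ...   | suc k′ = Long.win-with-chord {i * d} {d + (d + k′ * d)}
                         (+-monoʳ-≤ d (+-monoʳ-≤ d z≤n)) (≤-trans (≤-reflexive (sym eq)) jd≤) D₀≤d
                         path (subst (Blue h′ (i * d)) eq chord)
        where
        eq : (suc i + suc k′) * d ≡ i * d + (d + (d + k′ * d))
        eq = lem i k′ d
          where
          lem : ∀ i k d → (1 + i + (1 + k)) * d ≡ i * d + (d + (d + k * d))
          lem = solve-∀
        jd≤ : (suc i + suc k′) * d ≤ d * q
        jd≤ = ≤-trans (*-monoˡ-≤ d j≤q) (≤-reflexive (*-comm q d))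

    -- The opening complete graph settles `d < D₀`, since its blue clique then has room for the
    -- whole cycle; for larger `d`, `win-long` takes over.
    win : PathIn h → Win cost h
    win path = draw-grid id id r λ s col → continue (λ i → s ∘ path i)
      (ramsey-clique {xs = applyUpTo id r} N D₀ (≤-reflexive (sym (length-applyUpTo id r))) (applyUpTo⁺₁ id r col))
      where
      r = ramsey N D₀
      continue : PathIn h′ → Clique (Red h′) N (applyUpTo id r) ⊎ Clique (Blue h′) D₀ (applyUpTo id r) →
                 Win (pairs N + (pairs ρ + (pairs (suc u) + (pairs (suc b) + 0)))) h′
      continue path (inj₁ (_ , _ , len , reds)) = red-wins len reds
      continue path (inj₂ (_ , _ , len , blues)) with d <? D₀
      ... | yes d<D₀ = ended (blueH (clique⇒copy mono (≤-trans d<D₀ (≤-reflexive (sym len))) blues))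
      ... | no  d≮D₀ = win-long (≮⇒≥ d≮D₀) path

-- From the path game to the cycle game

play : ∀ k (G : OrdGraph) → size G ≤ 2 + k → ∀ n t →
       RoLe G (Path (n * suc k + 1)) t → RoLe G (Cycle (suc n)) (t + Strategy.cost k)
play k G small n t builder = BuilderWins-then builder λ {h} copy →
  let v , mono , edges = extend-path (subst (λ M → MonoCopy (Path M) blue h) (+-comm (n * suc k) 1) copy)
  in Strategy.win k small n mono edges

trivial-copy : size G ≤ 1 → MonoCopy G red []
trivial-copy {G} size≤1 = toℕ , (λ _ _ → id) , λ i j i<j _ →
  contradiction (≤-trans (s≤s i<j) (≤-trans (toℕ<n j) size≤1)) λ { (s≤s ()) }

theorem1p8 : (G : OrdGraph) → Σ ℕ λ c → (n : ℕ) → n ≥ 1 → (t : ℕ) →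
    RoLe G (Path ((n ∸ 1) * (size G ∸ 1) + 1)) t →
    RoLe G (Cycle n) (t + c)
theorem1p8 G = go (size G) refl
  where
  go : ∀ s → size G ≡ s → Σ ℕ λ c → (n : ℕ) → n ≥ 1 → (t : ℕ) →
       RoLe G (Path ((n ∸ 1) * (size G ∸ 1) + 1)) t → RoLe G (Cycle n) (t + c)
  -- With at most one vertex there are no edges, so the empty history already contains a red copy;
  -- `Strategy` starts at two vertices.
  go zero          eq = 0 , λ _ _ _ _ → ended (redG (trivial-copy (≤-trans (≤-reflexive eq) z≤n)))
  go (suc zero)    eq = 0 , λ _ _ _ _ → ended (redG (trivial-copy (≤-reflexive eq)))
  go (suc (suc k)) eq = Strategy.cost k , λ { (suc n) _ t builder →
    play k G (≤-reflexive eq) n t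
      (subst (λ s → RoLe G (Path (n * (s ∸ 1) + 1)) t) eq builder) }
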